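{- Let $\mathcal{H}$ be a $k$-uniform hypergraph with $n$ vertices, and let $\mathcal{S}(\mathcal{H})$ be its Seidel matrix. Then $$\|\mathcal{S}(\mathcal{H})\|_F\ge\sqrt{n(n-1)},$$ and equality holds if and only if $\mathcal{H}$ is linear.
   Context: A hypergraph $\mathcal{H}=(V,E)$ consists of a finite vertex set $V$ with $|V|=n$ (identified with $\{1,\dots,n\}$) and a set $E\subseteq 2^{V}$ of hyperedges. All hypergraphs are finite and simple: there is no hyperedge of size $1$, and for distinct hyperedges $e,e'$ neither $e\subset e'$ nor $e'\subset e$. $\mathcal{H}$ is $k$-uniform if every hyperedge has exactly $k$ elements. For distinct vertices $i,j$, the co-degree is $c_{ij}=|\{e\in E: i,j\in e\}|$. The Seidel matrix $\mathcal{S}(\mathcal{H})$ is the real symmetric $n\times n$ matrix with $\mathcal{S}(\mathcal{H})_{ii}=0$ and $\mathcal{S}(\mathcal{H})_{ij}=1-2c_{ij}$ for $i\ne j$. The Frobenius norm of a matrix $M=(m_{ij})$ is $\|M\|_F=\left(\sum_{i,j}|m_{ij}|^2\right)^{1/2}$. A hypergraph is linear if it is simple and $|e\cap e'|\le 1$ for all distinct hyperedges $e,e'$. -}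

module Defs where

open import Data.Bool.Base using (if_then_else_)
open import Data.Fin.Base using (Fin)
import Data.Fin.Properties as Fin
open import Data.Fin.Subset using (Subset; _∩_; _⊂_) renaming (∣_∣ to card)
open import Data.Fin.Subset.Properties using (_∈?_)
open import Data.Integer.Base as ℤ using (ℤ; +_; 0ℤ; 1ℤ)
open import Data.List.Base using (List; length; filter)
open import Data.List.Membership.Propositional using (_∈_)
open import Data.List.Relation.Unary.Unique.Propositional using (Unique)
open import Data.Nat.Base as ℕ using (ℕ)
import Data.Nat.Properties as ℕ
open import Algebra.Properties.CommutativeMonoid.Sum ℕ.+-0-commutativeMonoid using (sum-syntax)
open import Data.Product.Base using (∃-syntax; _×_; _,_)
open import Data.Rational.Base
open import Data.Rational.Properties
open import Data.Rational.Solver using (module +-*-Solver)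
open import Data.Sum.Base using (_⊎_; inj₁; inj₂)
open import Relation.Binary.PropositionalEquality using (_≡_; _≢_; refl; sym; trans; cong; subst; subst₂)
open import Relation.Nullary using (¬_; yes; no)
open import Relation.Nullary.Decidable using (does; _×-dec_)

-- Dedekind reals, with two-sided rational cuts.
record ℝ : Set₁ where
  field
    L U         : ℚ → Set
    L-inhabited : ∃[ q ] L q
    U-inhabited : ∃[ q ] U q
    L-lower     : ∀ {p q} → p < q → L q → L p
    U-upper     : ∀ {p q} → p < q → U p → U q
    L-open      : ∀ {q} → L q → ∃[ r ] (q < r × L r)
    U-open      : ∀ {q} → U q → ∃[ r ] (r < q × U r)
    disjoint    : ∀ {q} → ¬ (L q × U q)
    located     : ∀ {p q} → p < q → L p ⊎ U q

infix 4 _≤ᴿ_ _≥ᴿ_ _≃ᴿ_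

-- Comparing lower cuts suffices: by openness, locatedness and disjointness,
-- each cut of a real determines the other.
_≤ᴿ_ _≥ᴿ_ _≃ᴿ_ : ℝ → ℝ → Set
a ≤ᴿ b = ∀ q → ℝ.L a q → ℝ.L b q
a ≥ᴿ b = b ≤ᴿ a
a ≃ᴿ b = a ≤ᴿ b × b ≤ᴿ a

private
  0<diff : ∀ {p q} → p < q → 0ℚ < q - p
  0<diff {p} {q} p<q = subst (_< q - p) (+-inverseʳ p) (+-monoˡ-< (- p) p<q)

  *-0< : ∀ {p q} → 0ℚ < p → 0ℚ < q → 0ℚ < p * q
  *-0< {p} {q} 0<p 0<q =
    positive⁻¹ (p * q) {{pos*pos⇒pos p {{positive 0<p}} q {{positive 0<q}}}}

  <-by-diff : ∀ {p d q} → p + d ≡ q → 0ℚ < d → p < q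
  <-by-diff {p} {d} p+d≡q 0<d = subst₂ _<_ (+-identityʳ p) p+d≡q (+-monoʳ-< p 0<d)

  sq-mono : ∀ {p q} → 0ℚ ≤ p → p ≤ q → p * p ≤ q * q
  sq-mono {p} {q} 0≤p p≤q = ≤-trans
    (*-monoˡ-≤-nonNeg p {{nonNegative 0≤p}} p≤q)
    (*-monoʳ-≤-nonNeg q {{nonNegative (≤-trans 0≤p p≤q)}} p≤q)

  -- One step  q ↦ (s q + x) / (q + s)  with s = x + 1 moves q strictly
  -- towards √ x without crossing it, because
  --   (s q + x)² - x (q + s)² = (q² - x) (s² - x)   and   s² > x.
  module Step (x : ℚ) (0≤x : 0ℚ ≤ x) (q : ℚ) (0≤q : 0ℚ ≤ q) where
    open +-*-Solver

    s n d : ℚ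
    s = x + 1ℚ
    n = s * q + x
    d = q + s

    0<s : 0ℚ < s
    0<s = +-mono-≤-< 0≤x (positive⁻¹ 1ℚ)

    0<d : 0ℚ < d
    0<d = +-mono-≤-< 0≤q 0<s

    instance
      d-pos : Positive d
      d-pos = positive 0<d
      d-nonZero : NonZero d
      d-nonZero = pos⇒nonZero d

    t r : ℚ
    t = 1/ d
    r = n * t

    instance
      t-pos : Positive t
      t-pos = 1/pos⇒pos d

    0<t : 0ℚ < t
    0<t = positive⁻¹ t

    instance
      tt-pos : Positive (t * t)
      tt-pos = pos*pos⇒pos t t

    0<s²-x : 0ℚ < s * s - x
    0<s²-x = subst (0ℚ <_)
      (solve 1 (λ x → x :* x :+ x :+ con 1ℚ := (x :+ con 1ℚ) :* (x :+ con 1ℚ) :- x) refl x)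
      (+-mono-≤-< (+-mono-≤ 0≤xx 0≤x) (positive⁻¹ 1ℚ))
      where
      0≤xx : 0ℚ ≤ x * x
      0≤xx = sq-mono ≤-refl 0≤x

    q≡ : q * d * t ≡ q
    q≡ = trans (*-assoc q d t) (trans (cong (q *_) (*-inverseʳ d)) (*-identityʳ q))

    x≡ : x * (d * d) * (t * t) ≡ x
    x≡ = trans
      (solve 3 (λ x d t → x :* (d :* d) :* (t :* t) := x :* ((d :* t) :* (d :* t))) refl x d t)
      (trans (cong (λ u → x * (u * u)) (*-inverseʳ d)) (*-identityʳ x))

    r²≡ : n * n * (t * t) ≡ r * r
    r²≡ = solve 2 (λ n t → n :* n :* (t :* t) := (n :* t) :* (n :* t)) refl n t

    up : q * q < x → q < r × r * r < x
    up q²<x = subst (_< r) q≡ (*-monoˡ-<-pos t qd<n) , subst₂ _<_ r²≡ x≡ (*-monoˡ-<-pos (t * t) n²<xd²)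
      where
      qd<n : q * d < n
      qd<n = <-by-diff
        (solve 3 (λ x q s → q :* (q :+ s) :+ (x :- q :* q) := s :* q :+ x) refl x q s)
        (0<diff q²<x)
      n²<xd² : n * n < x * (d * d)
      n²<xd² = <-by-diff
        (solve 3 (λ x q s → (s :* q :+ x) :* (s :* q :+ x) :+ (x :- q :* q) :* (s :* s :- x)
                         := x :* ((q :+ s) :* (q :+ s))) refl x q s)
        (*-0< (0<diff q²<x) 0<s²-x)

    down : x < q * q → r < q × x < r * r
    down x<q² = subst (r <_) q≡ (*-monoˡ-<-pos t n<qd) , subst₂ _<_ x≡ r²≡ (*-monoˡ-<-pos (t * t) xd²<n²)
      where
      n<qd : n < q * d
      n<qd = <-by-diff
        (solve 3 (λ x q s → s :* q :+ x :+ (q :* q :- x) := q :* (q :+ s)) refl x q s)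
        (0<diff x<q²)
      xd²<n² : x * (d * d) < n * n
      xd²<n² = <-by-diff
        (solve 3 (λ x q s → x :* ((q :+ s) :* (q :+ s)) :+ (q :* q :- x) :* (s :* s :- x)
                         := (s :* q :+ x) :* (s :* q :+ x)) refl x q s)
        (*-0< (0<diff x<q²) 0<s²-x)

    0<r : 0ℚ < q → 0ℚ < r
    0<r 0<q = *-0< (+-mono-<-≤ (*-0< 0<s 0<q) 0≤x) 0<t

sqrt : (x : ℚ) → 0ℚ ≤ x → ℝ
sqrt x 0≤x = record
  { L           = λ q → q < 0ℚ ⊎ q * q < x
  ; U           = λ q → 0ℚ < q × x < q * q
  ; L-inhabited = - 1ℚ , inj₁ (negative⁻¹ (- 1ℚ))
  ; U-inhabited = x + 1ℚ , 0<s , <-by-diff x+[s²-x]≡s² 0<s²-x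
  ; L-lower     = lower
  ; U-upper     = λ p<q (0<p , x<p²) →
                    <-trans 0<p p<q , <-≤-trans x<p² (sq-mono (<⇒≤ 0<p) (<⇒≤ p<q))
  ; L-open      = open↑
  ; U-open      = λ {q} (0<q , x<q²) →
                    let open Step x 0≤x q (<⇒≤ 0<q)
                        r<q , x<r² = down x<q²
                    in r , r<q , 0<r 0<q , x<r²
  ; disjoint    = λ { (inj₁ q<0  , 0<q , _)  → <-asym q<0 0<q
                    ; (inj₂ q²<x , _ , x<q²) → <-asym q²<x x<q² }
  ; located     = loc
  }
  where
  open Step x 0≤x 0ℚ ≤-refl using (0<s; 0<s²-x)

  x+[s²-x]≡s² : x + ((x + 1ℚ) * (x + 1ℚ) - x) ≡ (x + 1ℚ) * (x + 1ℚ)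
  x+[s²-x]≡s² = solve 2 (λ x y → x :+ (y :- x) := y) refl x ((x + 1ℚ) * (x + 1ℚ))
    where open +-*-Solver

  lower : ∀ {p q} → p < q → q < 0ℚ ⊎ q * q < x → p < 0ℚ ⊎ p * p < x
  lower p<q (inj₁ q<0) = inj₁ (<-trans p<q q<0)
  lower {p} p<q (inj₂ q²<x) with p <? 0ℚ
  ... | yes p<0 = inj₁ p<0
  ... | no  p≮0 = inj₂ (≤-<-trans (sq-mono (≮⇒≥ p≮0) (<⇒≤ p<q)) q²<x)

  open↑ : ∀ {q} → q < 0ℚ ⊎ q * q < x → ∃[ r ] (q < r × (r < 0ℚ ⊎ r * r < x))
  open↑ (inj₁ q<0) = let r , q<r , r<0 = <-dense q<0 in r , q<r , inj₁ r<0
  open↑ {q} (inj₂ q²<x) with q <? 0ℚ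
  ... | yes q<0 = let r , q<r , r<0 = <-dense q<0 in r , q<r , inj₁ r<0
  ... | no  q≮0 = let open Step x 0≤x q (≮⇒≥ q≮0)
                      q<r , r²<x = up q²<x
                  in r , q<r , inj₂ r²<x

  loc : ∀ {p q} → p < q → (p < 0ℚ ⊎ p * p < x) ⊎ (0ℚ < q × x < q * q)
  loc {p} {q} p<q with p <? 0ℚ | p * p <? x
  ... | yes p<0 | _        = inj₁ (inj₁ p<0)
  ... | no  _   | yes p²<x = inj₁ (inj₂ p²<x)
  ... | no  p≮0 | no  p²≮x = inj₂ (0<q , ≤-<-trans (≮⇒≥ p²≮x) p²<q²)
    where
    0≤p : 0ℚ ≤ p
    0≤p = ≮⇒≥ p≮0
    0<q : 0ℚ < q
    0<q = ≤-<-trans 0≤p p<q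
    p²<q² : p * p < q * q
    p²<q² = ≤-<-trans
      (*-monoˡ-≤-nonNeg p {{nonNegative 0≤p}} (<⇒≤ p<q))
      (*-monoˡ-<-pos q {{positive 0<q}} p<q)

√ : ℕ → ℝ
√ m = sqrt (+ m / 1) (nonNegative⁻¹ (+ m / 1) {{normalize-nonNeg m 1}})

-- e and e′ range over ordered pairs, so neither of two distinct hyperedges
-- contains the other.
Simple : ∀ {n} → List (Subset n) → Set
Simple E = (∀ {e} → e ∈ E → card e ≢ 1)
         × (∀ {e e′} → e ∈ E → e′ ∈ E → e ≢ e′ → ¬ (e ⊂ e′))

-- A set of hyperedges is a duplicate-free list, so that filtering and
-- taking lengths computes cardinalities.
record Hypergraph (n : ℕ) : Set where
  field
    edges  : List (Subset n)
    unique : Unique edges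
    simple : Simple edges

open Hypergraph public

Uniform : ∀ {n} → ℕ → Hypergraph n → Set
Uniform k H = ∀ {e} → e ∈ edges H → card e ≡ k

Linear : ∀ {n} → Hypergraph n → Set
Linear H = Simple (edges H)
         × (∀ {e e′} → e ∈ edges H → e′ ∈ edges H → e ≢ e′ → card (e ∩ e′) ℕ.≤ 1)

codegree : ∀ {n} → Hypergraph n → Fin n → Fin n → ℕ
codegree H i j = length (filter (λ e → (i ∈? e) ×-dec (j ∈? e)) (edges H))

-- Seidel matrices have integer entries; only their norms need ℝ.
Matrix : ℕ → Set
Matrix n = Fin n → Fin n → ℤ

Seidel : ∀ {n} → Hypergraph n → Matrix n
Seidel H i j = if does (i Fin.≟ j) then 0ℤ else 1ℤ ℤ.- (+ 2) ℤ.* (+ codegree H i j)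

‖_‖F : ∀ {n} → Matrix n → ℝ
‖_‖F {n} M = √ (∑[ i < n ] ∑[ j < n ] (ℤ.∣ M i j ∣ ℕ.^ 2))

{-# OPTIONS --safe #-}

-- An off-diagonal entry 1 − 2c is odd, so its square is at least 1, with equality
-- exactly when c ≤ 1; summing, ‖S‖² ≥ n (n − 1), with equality exactly when all
-- codegrees are at most 1. Some two vertices lie in two common hyperedges exactly
-- when some two hyperedges share two vertices. Equality of the norms
-- as cuts gives equality of the integers under the roots, because a rational
-- square lies in every interval [a, a + 1).
module Submission where

open import Defs
open import Data.Nat.Base using (ℕ; _*_; _∸_)
open import Data.Product.Base using (_×_)
open import Function.Bundles using (_⇔_)

open import Data.Bool.Base using (if_then_else_; true; false)
open import Data.Fin.Base using (Fin; zero; suc; punchIn)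
import Data.Fin.Properties as Fin
open import Data.Fin.Subset using (Subset; _∩_; inside; outside; Nonempty)
  renaming (_∈_ to _∈ˢ_; ∣_∣ to card)
open import Data.Fin.Subset.Properties
  using (_∈?_; x∈p∩q⁺; x∈p∩q⁻; x∈p∧x≢y⇒x∈p-y; x∈p⇒∣p-x∣<∣p∣)
open import Data.Integer.Base as ℤ using (+_; 0ℤ; 1ℤ)
import Data.Integer.Properties as ℤ
open import Data.List.Base using (List; []; _∷_; length)
open import Data.List.Membership.Propositional using (_∈_)
open import Data.List.Membership.Propositional.Properties using (∈-filter⁺; ∈-filter⁻; ∈-length)
open import Data.List.Relation.Unary.All using (_∷_)
open import Data.List.Relation.Unary.AllPairs using (_∷_)
open import Data.List.Relation.Unary.Any using (here; there)
open import Data.List.Relation.Unary.Unique.Propositional using (Unique)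
open import Data.List.Relation.Unary.Unique.Propositional.Properties using (filter⁺)
open import Data.Nat.Base using (zero; suc; _+_; _^_; _≤_; _<_; z≤n; s≤s)
open import Data.Nat.Properties
open import Algebra.Properties.CommutativeMonoid.Sum +-0-commutativeMonoid
  using (sum; sum-syntax; sum-cong-≗; sum-remove)
open import Data.Nat.Solver using (module +-*-Solver)
open import Data.Product.Base using (∃-syntax; _,_)
open import Data.Rational.Base as ℚ using (fromℚᵘ; toℚᵘ)
import Data.Rational.Properties as ℚ
open import Data.Rational.Unnormalised.Base as ℚᵘ using (mkℚᵘ; *≤*; *<*)
import Data.Rational.Unnormalised.Properties as ℚᵘ
open import Data.Sum.Base using (inj₁; inj₂)
open import Data.Vec.Base using ([]; _∷_; here; there)
open import Function.Base using (_∘_; case_of_)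
open import Function.Bundles using (mk⇔)
open import Relation.Binary.PropositionalEquality
open import Relation.Nullary using (yes; no; contradiction)
open import Relation.Nullary.Decidable using (does; dec-true; dec-false; _×-dec_)
open import Relation.Unary using (Decidable)

-- Order on rationals, and monotonicity of the root.

fromℚᵘ-mono-≤ : ∀ p q → p ℚᵘ.≤ q → fromℚᵘ p ℚ.≤ fromℚᵘ q
fromℚᵘ-mono-≤ p q p≤q = ℚ.toℚᵘ-cancel-≤
  (ℚᵘ.≤-respʳ-≃ (ℚᵘ.≃-sym (ℚ.toℚᵘ-fromℚᵘ q))
    (ℚᵘ.≤-respˡ-≃ (ℚᵘ.≃-sym (ℚ.toℚᵘ-fromℚᵘ p)) p≤q))

fromℚᵘ-mono-< : ∀ p q → p ℚᵘ.< q → fromℚᵘ p ℚ.< fromℚᵘ q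
fromℚᵘ-mono-< p q p<q = ℚ.toℚᵘ-cancel-<
  (ℚᵘ.<-respʳ-≃ (ℚᵘ.≃-sym (ℚ.toℚᵘ-fromℚᵘ q))
    (ℚᵘ.<-respˡ-≃ (ℚᵘ.≃-sym (ℚ.toℚᵘ-fromℚᵘ p)) p<q))

fromℚᵘ-homo-* : ∀ p q → fromℚᵘ (p ℚᵘ.* q) ≡ fromℚᵘ p ℚ.* fromℚᵘ q
fromℚᵘ-homo-* p q = ℚ.toℚᵘ-injective (begin
  toℚᵘ (fromℚᵘ (p ℚᵘ.* q))               ≈⟨ ℚ.toℚᵘ-fromℚᵘ (p ℚᵘ.* q) ⟩
  p ℚᵘ.* q                               ≈⟨ ℚᵘ.*-cong (ℚ.toℚᵘ-fromℚᵘ p) (ℚ.toℚᵘ-fromℚᵘ q) ⟨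
  toℚᵘ (fromℚᵘ p) ℚᵘ.* toℚᵘ (fromℚᵘ q)   ≈⟨ ℚ.toℚᵘ-homo-* (fromℚᵘ p) (fromℚᵘ q) ⟨
  toℚᵘ (fromℚᵘ p ℚ.* fromℚᵘ q)           ∎)
  where open import Relation.Binary.Reasoning.Setoid ℚᵘ.≃-setoid

-- `+ a / 1` is what `fromℚᵘ (mkℚᵘ (+ a) 0)` unfolds to, so the comparison becomes integer
-- cross-multiplication.
/1-mono-≤ : ∀ {a b} → a ≤ b → + a ℚ./ 1 ℚ.≤ + b ℚ./ 1
/1-mono-≤ {a} {b} a≤b = fromℚᵘ-mono-≤ (mkℚᵘ (+ a) 0) (mkℚᵘ (+ b) 0)
  (*≤* (ℤ.*-monoʳ-≤-nonNeg 1ℤ (ℤ.+≤+ a≤b)))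

√-mono-≤ : ∀ {a b} → a ≤ b → √ a ≤ᴿ √ b
√-mono-≤ a≤b q (inj₁ q<0)  = inj₁ q<0
√-mono-≤ a≤b q (inj₂ q²<a) = inj₂ (ℚ.<-≤-trans q²<a (/1-mono-≤ a≤b))

-- Integer roots, and recovering integers from cuts.

m²≤n²⇒m≤n : ∀ {m n} → m * m ≤ n * n → m ≤ n
m²≤n²⇒m≤n m²≤n² = ≮⇒≥ λ n<m → <⇒≱ (*-mono-< n<m n<m) m²≤n²

m≤m*m : ∀ m → m ≤ m * m
m≤m*m zero    = z≤n
m≤m*m (suc m) = m≤m*n (suc m) (suc m)

⌊√⌋ : ∀ x → ∃[ r ] (r * r ≤ x × x < suc r * suc r)
⌊√⌋ zero = 0 , z≤n , s≤s z≤n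
⌊√⌋ (suc x) with r , r²≤x , x<[1+r]² ← ⌊√⌋ x | suc r * suc r ≤? suc x
-- One increment of `x` raises the root by at most one: `suc x ≤ (r + 1)² < (r + 2)²`.
... | yes [1+r]²≤1+x = suc r , [1+r]²≤1+x ,
                       ≤-<-trans x<[1+r]² (*-mono-< (n<1+n (suc r)) (n<1+n (suc r)))
... | no  [1+r]²≰1+x = r , m≤n⇒m≤1+n r²≤x , ≰⇒> [1+r]²≰1+x

-- With N = 2 (a + 1) and r = ⌊√ (a N²)⌋ ≤ a N, the square (r + 1)² exceeds
-- a N² by at most 2 r + 1 ≤ 2 a N + 1 < N².
square-between : ∀ a → ∃[ m ] ∃[ d ]
  (a * (suc d * suc d) ≤ m * m × m * m < suc a * (suc d * suc d))
square-between a with r , r²≤aN² , aN²<[1+r]² ← ⌊√⌋ (a * (2 * suc a * (2 * suc a))) =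
  suc r , a + 1 * suc a , <⇒≤ aN²<[1+r]² , (begin-strict
    suc r * suc r                      ≡⟨ solve 1 (λ r → (con 1 :+ r) :* (con 1 :+ r)
                                                     := r :* r :+ (con 2 :* r :+ con 1)) refl r ⟩
    r * r + (2 * r + 1)                ≤⟨ +-mono-≤ r²≤aN² (+-monoˡ-≤ 1 (*-monoʳ-≤ 2 r≤aN)) ⟩
    a * (N * N) + (2 * (a * N) + 1)    <⟨ +-monoʳ-< (a * (N * N)) (+-monoʳ-< (2 * (a * N)) 1<2N) ⟩
    a * (N * N) + (2 * (a * N) + 2 * N)
      ≡⟨ solve 1 (λ a → let N = con 2 :* (con 1 :+ a) in
           a :* (N :* N) :+ (con 2 :* (a :* N) :+ con 2 :* N) := (con 1 :+ a) :* (N :* N)) refl a ⟩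
    suc a * (N * N)                    ∎)
  where
  open ≤-Reasoning
  open +-*-Solver
  N : ℕ
  N = 2 * suc a
  1<2N : 1 < 2 * N
  1<2N = *-monoʳ-≤ 2 {1} {N} (s≤s z≤n)
  r≤aN : r ≤ a * N
  r≤aN = m²≤n²⇒m≤n (begin
    r * r               ≤⟨ r²≤aN² ⟩
    a * (N * N)         ≤⟨ *-monoˡ-≤ (N * N) (m≤m*m a) ⟩
    a * a * (N * N)     ≡⟨ solve 2 (λ a N → a :* a :* (N :* N) := a :* N :* (a :* N)) refl a N ⟩
    a * N * (a * N)     ∎)

-- If `a < b`, a nonnegative rational `q` with `a ≤ q² < a + 1 ≤ b` lies in the lower cut of `√ b`
-- but not in that of `√ a`.
√-cancel-≤ : ∀ {a b} → √ b ≤ᴿ √ a → b ≤ a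
√-cancel-≤ {a} {b} √b≤√a = ≮⇒≥ λ a<b →
  let m , d , aN²≤m² , m²<[1+a]N² = square-between a
      -- `mkℚᵘ` takes the predecessor of the denominator, so this is `m / (d + 1)`.
      q = mkℚᵘ (+ m) d
      -- Excludes the disjunct `q < 0` of the lower cut of `√ a`.
      0≤q : ℚ.0ℚ ℚ.≤ fromℚᵘ q
      0≤q = fromℚᵘ-mono-≤ ℚᵘ.0ℚᵘ q (*≤* (subst (0ℤ ℤ.≤_) (ℤ.pos-* m 1) (ℤ.+≤+ z≤n)))
      a≤q² : + a ℚ./ 1 ℚ.≤ fromℚᵘ q ℚ.* fromℚᵘ q
      a≤q² = subst (+ a ℚ./ 1 ℚ.≤_) (fromℚᵘ-homo-* q q)
        (fromℚᵘ-mono-≤ (mkℚᵘ (+ a) 0) (q ℚᵘ.* q) (*≤* (subst₂ ℤ._≤_ (ℤ.pos-* a _)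
          (trans (ℤ.pos-* m m) (sym (ℤ.*-identityʳ (+ m ℤ.* + m)))) (ℤ.+≤+ aN²≤m²))))
      q²<b : fromℚᵘ q ℚ.* fromℚᵘ q ℚ.< + b ℚ./ 1
      q²<b = subst (ℚ._< + b ℚ./ 1) (fromℚᵘ-homo-* q q)
        (fromℚᵘ-mono-< (q ℚᵘ.* q) (mkℚᵘ (+ b) 0) (*<* (subst₂ ℤ._<_
          (trans (ℤ.pos-* m m) (sym (ℤ.*-identityʳ (+ m ℤ.* + m)))) (ℤ.pos-* b _)
          (ℤ.+<+ (<-≤-trans m²<[1+a]N² (*-monoˡ-≤ (suc d * suc d) a<b))))))
  in case √b≤√a (fromℚᵘ q) (inj₂ q²<b) of λ
       { (inj₁ q<0)  → ℚ.<-irrefl refl (ℚ.<-≤-trans q<0 0≤q)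
       ; (inj₂ q²<a) → ℚ.<-irrefl refl (ℚ.<-≤-trans q²<a a≤q²) }

-- Finite sums.

sum-mono-≤ : ∀ {n} {f g : Fin n → ℕ} → (∀ i → f i ≤ g i) → sum f ≤ sum g
sum-mono-≤ {zero}  f≤g = z≤n
sum-mono-≤ {suc n} f≤g = +-mono-≤ (f≤g zero) (sum-mono-≤ (f≤g ∘ suc))

-- A strict inequality in one term cannot be compensated by the others: bound the remaining terms by
-- `f≤g` and cancel them.
sum-cancel-≤ : ∀ {n} {f g : Fin n → ℕ} → (∀ i → f i ≤ g i) → sum g ≤ sum f → ∀ i → g i ≤ f i
sum-cancel-≤ {suc n} {f} {g} f≤g Σg≤Σf zero = +-cancelʳ-≤ (sum (g ∘ suc)) (g zero) (f zero)
  (≤-trans Σg≤Σf (+-monoʳ-≤ (f zero) (sum-mono-≤ (f≤g ∘ suc))))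
sum-cancel-≤ {suc n} {f} {g} f≤g Σg≤Σf (suc i) = sum-cancel-≤ (f≤g ∘ suc)
  (+-cancelˡ-≤ (g zero) (sum (g ∘ suc)) (sum (f ∘ suc))
    (≤-trans Σg≤Σf (+-monoˡ-≤ (sum (f ∘ suc)) (f≤g zero)))) i

sum-const : ∀ n {x} → ∑[ i < n ] x ≡ n * x
sum-const zero    = refl
sum-const (suc n) {x} = cong (_+_ x) (sum-const n)

-- The squared Seidel entries when all codegrees are at most 1. It branches on the same test as
-- `Seidel`, so one case split reduces both.
offDiagonal : ∀ {n} → Fin n → Fin n → ℕ
offDiagonal i j = if does (i Fin.≟ j) then 0 else 1

sum-offDiagonal : ∀ n → ∑[ i < n ] ∑[ j < n ] offDiagonal i j ≡ n * (n ∸ 1)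
sum-offDiagonal n = trans (sum-cong-≗ (row {n})) (sum-const n)
  where
  row : ∀ {n} (i : Fin n) → sum (offDiagonal i) ≡ n ∸ 1
  -- An index `i` forces a positive size, so `∸ 1` does not truncate; at size zero the outer sum is
  -- empty.
  row {suc n} i = begin
    sum (offDiagonal i)                                        ≡⟨ sum-remove {i = i} (offDiagonal i) ⟩
    offDiagonal i i + ∑[ j < n ] offDiagonal i (punchIn i j)   ≡⟨ cong₂ _+_ diagonal (sum-cong-≗ off) ⟩
    ∑[ j < n ] 1                                               ≡⟨ sum-const n ⟩
    n * 1                                                      ≡⟨ *-identityʳ n ⟩
    n                                                          ∎
    where
    open ≡-Reasoning
    diagonal : offDiagonal i i ≡ 0
    diagonal = cong (if_then 0 else 1) (dec-true (i Fin.≟ i) refl)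
    off : ∀ j → offDiagonal i (punchIn i j) ≡ 1
    off j = cong (if_then 0 else 1) (dec-false (i Fin.≟ punchIn i j) (Fin.punchInᵢ≢i i j ∘ sym))

-- Squares of off-diagonal entries.

squaredEntry : ℕ → ℕ
squaredEntry c = ℤ.∣ 1ℤ ℤ.- (+ 2) ℤ.* (+ c) ∣ ^ 2

-- The absolute value is 1 at `0` and `1`; from `2` on it computes to a successor, and so does its
-- square.
1≤squaredEntry : ∀ c → 1 ≤ squaredEntry c
1≤squaredEntry 0             = s≤s z≤n
1≤squaredEntry 1             = s≤s z≤n
1≤squaredEntry (suc (suc c)) = s≤s z≤n

squaredEntry≤1⇒≤1 : ∀ c → squaredEntry c ≤ 1 → c ≤ 1
squaredEntry≤1⇒≤1 0             _ = z≤n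
squaredEntry≤1⇒≤1 1             _ = s≤s z≤n
squaredEntry≤1⇒≤1 (suc (suc c)) e²≤1 = contradiction e²≤1 (<⇒≱ (≤-trans 2≤e (m≤m*n e (e * 1))))
  where
  e : ℕ
  -- This is the absolute value of `1 - 2 (c + 2)`, namely `2 c + 3`, in the form to which the
  -- integer operations compute.
  e = suc (c + 1 * suc (suc c))
  2≤e : 2 ≤ e
  2≤e = s≤s (m≤n⇒m≤o+n c (s≤s z≤n))

≤1⇒squaredEntry≤1 : ∀ {c} → c ≤ 1 → squaredEntry c ≤ 1
≤1⇒squaredEntry≤1 z≤n       = s≤s z≤n
≤1⇒squaredEntry≤1 (s≤s z≤n) = s≤s z≤n

-- Two distinct elements in subsets and lists.

nonempty : ∀ {n} (p : Subset n) → 1 ≤ card p → Nonempty p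
nonempty (inside  ∷ p) _   = zero , here
nonempty (outside ∷ p) 1≤p = let i , i∈p = nonempty p 1≤p in suc i , there i∈p

2≤card⇒distinct : ∀ {n} (p : Subset n) → 2 ≤ card p →
                  ∃[ i ] ∃[ j ] (i ≢ j × i ∈ˢ p × j ∈ˢ p)
2≤card⇒distinct (inside ∷ p) (s≤s 1≤p) =
  let j , j∈p = nonempty p 1≤p in zero , suc j , (λ ()) , here , there j∈p
2≤card⇒distinct (outside ∷ p) 2≤p =
  let i , j , i≢j , i∈p , j∈p = 2≤card⇒distinct p 2≤p
  in suc i , suc j , i≢j ∘ Fin.suc-injective , there i∈p , there j∈p

-- Removing `j` and then `i` lowers the cardinality twice.
distinct⇒2≤card : ∀ {n} {p : Subset n} {i j} → i ≢ j → i ∈ˢ p → j ∈ˢ p → 2 ≤ card p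
distinct⇒2≤card i≢j i∈p j∈p =
  ≤-trans (s≤s (≤-<-trans z≤n (x∈p⇒∣p-x∣<∣p∣ (x∈p∧x≢y⇒x∈p-y i∈p i≢j)))) (x∈p⇒∣p-x∣<∣p∣ j∈p)

module _ {a} {A : Set a} where

  2≤length⇒distinct : {xs : List A} → Unique xs → 2 ≤ length xs →
                      ∃[ x ] ∃[ y ] (x ≢ y × x ∈ xs × y ∈ xs)
  2≤length⇒distinct {x ∷ y ∷ _} ((x≢y ∷ _) ∷ _) _ = x , y , x≢y , here refl , there (here refl)
  2≤length⇒distinct {_ ∷ []} _ (s≤s ())

  distinct⇒2≤length : {xs : List A} {x y : A} → x ≢ y → x ∈ xs → y ∈ xs → 2 ≤ length xs
  distinct⇒2≤length x≢y (here refl) (here refl) = contradiction refl x≢y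
  distinct⇒2≤length x≢y (here _)    (there y∈)  = s≤s (∈-length y∈)
  distinct⇒2≤length x≢y (there x∈)  (here _)    = s≤s (∈-length x∈)
  distinct⇒2≤length x≢y (there x∈)  (there y∈)  = m≤n⇒m≤1+n (distinct⇒2≤length x≢y x∈ y∈)

-- Codegrees and linearity.

join? : ∀ {n} (i j : Fin n) → Decidable (λ e → i ∈ˢ e × j ∈ˢ e)
join? i j e = (i ∈? e) ×-dec (j ∈? e)

module _ {n} (H : Hypergraph n) where

  offDiagonal≤ : ∀ i j → offDiagonal i j ≤ ℤ.∣ Seidel H i j ∣ ^ 2
  offDiagonal≤ i j with does (i Fin.≟ j)
  ... | true  = z≤n
  ... | false = 1≤squaredEntry (codegree H i j)

  ≤offDiagonal⇒codegree≤1 : ∀ i j → ℤ.∣ Seidel H i j ∣ ^ 2 ≤ offDiagonal i j →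
                            i ≢ j → codegree H i j ≤ 1
  ≤offDiagonal⇒codegree≤1 i j s≤o i≢j with i Fin.≟ j
  ... | yes i≡j = contradiction i≡j i≢j
  ... | no  _   = squaredEntry≤1⇒≤1 (codegree H i j) s≤o

  codegree≤1⇒≤offDiagonal : (∀ i j → i ≢ j → codegree H i j ≤ 1) →
                            ∀ i j → ℤ.∣ Seidel H i j ∣ ^ 2 ≤ offDiagonal i j
  codegree≤1⇒≤offDiagonal c≤1 i j with i Fin.≟ j
  ... | yes _   = z≤n
  ... | no  i≢j = ≤1⇒squaredEntry≤1 (c≤1 i j i≢j)

  linear⇒codegree≤1 : Linear H → ∀ i j → i ≢ j → codegree H i j ≤ 1
  linear⇒codegree≤1 (_ , e∩e′≤1) i j i≢j = ≮⇒≥ λ 2≤c →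
    -- `codegree H i j` is the length of the list filtered by `join? i j`. Filtering keeps it
    -- duplicate-free, so its first two entries are different hyperedges, both containing `i` and
    -- `j`.
    let e , e′ , e≢e′ , e∈ , e′∈     = 2≤length⇒distinct (filter⁺ (join? i j) (unique H)) 2≤c
        e∈E  , i∈e  , j∈e  = ∈-filter⁻ (join? i j) {xs = edges H} e∈
        e′∈E , i∈e′ , j∈e′ = ∈-filter⁻ (join? i j) {xs = edges H} e′∈
    in <⇒≱ (distinct⇒2≤card i≢j (x∈p∩q⁺ (i∈e , i∈e′)) (x∈p∩q⁺ (j∈e , j∈e′)))
           (e∩e′≤1 e∈E e′∈E e≢e′)

  -- Two vertices of `e ∩ e′` put both `e` and `e′` into the list that their codegree counts.
  codegree≤1⇒linear : (∀ i j → i ≢ j → codegree H i j ≤ 1) → Linear H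
  codegree≤1⇒linear c≤1 = simple H , λ {e} {e′} e∈E e′∈E e≢e′ → ≮⇒≥ λ 2≤e∩e′ →
    let i , j , i≢j , i∈ , j∈ = 2≤card⇒distinct (e ∩ e′) 2≤e∩e′
        i∈e , i∈e′ = x∈p∩q⁻ e e′ i∈
        j∈e , j∈e′ = x∈p∩q⁻ e e′ j∈
    in <⇒≱ (distinct⇒2≤length e≢e′ (∈-filter⁺ (join? i j) e∈E (i∈e , j∈e))
                                   (∈-filter⁺ (join? i j) e′∈E (i∈e′ , j∈e′)))
           (c≤1 i j i≢j)

theorem3p3 : ∀ (n k : ℕ) (H : Hypergraph n) → Uniform k H →
    (‖ Seidel H ‖F ≥ᴿ √ (n * (n ∸ 1))) × ((‖ Seidel H ‖F ≃ᴿ √ (n * (n ∸ 1))) ⇔ Linear H)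
theorem3p3 n k H _ = √-mono-≤ lower , mk⇔
  (λ (‖S‖≤ , _) → codegree≤1⇒linear H λ i j → ≤offDiagonal⇒codegree≤1 H i j
    -- The inner cancellation passes from the double sum to row `i`, the outer one from that row to
    -- the entry `j`.
    (sum-cancel-≤ (offDiagonal≤ H i)
      (sum-cancel-≤ (λ i → sum-mono-≤ (offDiagonal≤ H i))
        (subst (total ≤_) (sym (sum-offDiagonal n)) (√-cancel-≤ ‖S‖≤)) i) j))
  (λ linear → √-mono-≤ (subst (total ≤_) (sum-offDiagonal n)
      (sum-mono-≤ λ i → sum-mono-≤
        (codegree≤1⇒≤offDiagonal H (linear⇒codegree≤1 H linear) i)))
    , √-mono-≤ lower)
  where
  total : ℕ
  total = ∑[ i < n ] ∑[ j < n ] (ℤ.∣ Seidel H i j ∣ ^ 2)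

  lower : n * (n ∸ 1) ≤ total
  lower = subst (_≤ total) (sum-offDiagonal n) (sum-mono-≤ λ i → sum-mono-≤ (offDiagonal≤ H i))
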